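{- Let $C$ and $D$ be sets of nonnegative integers such that $C \cup D = \mathbb{N}$, $C \cap D = \emptyset$ and $0 \in C$. Then $R_C(n) = R_D(n)$ for every positive integer $n$ if and only if $C = A$ and $D = B$.
   Context: $\mathbb{N} = \{0,1,2,\dots\}$ denotes the set of nonnegative integers. For a set $S$ of nonnegative integers, $R_S(n)$ denotes the number of solutions of $s + s' = n$ with $s, s' \in S$ and $s < s'$. $A$ is the set of those nonnegative integers whose binary representation contains an even number of digits $1$ (so $0 \in A$), and $B = \mathbb{N} \setminus A$. -}

module Defs where

open import Data.Digit using (1b; toDigits)
import Data.Fin.Properties as Fin
open import Data.List.Base using (length; filter; upTo; cartesianProduct)
open import Data.Nat.Base using (ℕ; suc; _+_; _<_)
open import Data.Nat.Divisibility using (_∣_)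
open import Data.Nat.Properties using (_≟_; _<?_)
open import Data.Product.Base using (_×_; _,_; proj₁; proj₂)
open import Data.Sum.Base using (inj₁; inj₂)
open import Data.Unit.Base using (tt)
open import Level using (Level; 0ℓ)
open import Relation.Nullary.Decidable using (yes; no; _×-dec_)
open import Relation.Unary using (Pred; Decidable; _∈_; _∪_; _∩_; ∁; _≐_; U; ∅)
open import Relation.Binary.PropositionalEquality using (_≡_)

private
  variable
    c d ℓ : Level

IsRepresentation : Pred ℕ ℓ → ℕ → Pred (ℕ × ℕ) ℓ
IsRepresentation S n (s , s′) = s ∈ S × s′ ∈ S × s < s′ × s + s′ ≡ n

isRepresentation? : {S : Pred ℕ ℓ} → Decidable S → (n : ℕ) →
                    Decidable (IsRepresentation S n)
isRepresentation? S? n (s , s′) =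
  S? s ×-dec S? s′ ×-dec (s <? s′) ×-dec (s + s′ ≟ n)

-- R_S(n).  Any solution of s + s′ = n has s, s′ ≤ n, so searching
-- {0,…,n}² finds each solution exactly once.
R : {S : Pred ℕ ℓ} → Decidable S → ℕ → ℕ
R S? n = length (filter (isRepresentation? S? n)
                        (cartesianProduct (upTo (suc n)) (upTo (suc n))))

-- Only the ones are counted, so any leading zeros in toDigits are harmless.
binaryOnes : ℕ → ℕ
binaryOnes n = length (filter (Fin._≟ 1b) (proj₁ (toDigits 2 n)))

A : Pred ℕ 0ℓ
A n = 2 ∣ binaryOnes n

B : Pred ℕ 0ℓ
B = ∁ A

-- Counting in R requires decidable membership.  Read constructively,
-- C ∪ D = ℕ and C ∩ D = ∅ already decide membership in C and in D, so
-- decidability need not be a separate hypothesis on the two sets.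
module _ {C : Pred ℕ c} {D : Pred ℕ d}
         (C∪D≐ℕ : C ∪ D ≐ U) (C∩D≐∅ : C ∩ D ≐ ∅) where

  partition⇒decidableˡ : Decidable C
  partition⇒decidableˡ n with proj₂ C∪D≐ℕ {n} tt
  ... | inj₁ n∈C = yes n∈C
  ... | inj₂ n∈D = no λ n∈C → proj₁ C∩D≐∅ (n∈C , n∈D)

  partition⇒decidableʳ : Decidable D
  partition⇒decidableʳ n with proj₂ C∪D≐ℕ {n} tt
  ... | inj₁ n∈C = no λ n∈D → proj₁ C∩D≐∅ (n∈C , n∈D)
  ... | inj₂ n∈D = yes n∈D

{-# OPTIONS --safe #-}

-- Put ε(s) = 1 for s ∈ C and ε(s) = −1 for s ∈ D.  A pair s < s′ with
-- s + s′ = n contributes (ε(s) + ε(s′)) / 2 to R_C(n) − R_D(n), so twice this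
-- difference is the sum of ε over {0,…,n} without the midpoint n / 2.  Hence
-- R_C = R_D on the positive integers iff, for all m, the sum of ε up to 2m is
-- ε(m) and the sum of ε up to 2m + 1 is 0.  Taking differences, this says that
-- ε(2m) = ε(m) and ε(2m + 1) = −ε(m), which together with ε(0) = 1 is the
-- recursion of the parity of the number of binary digits 1.
module Submission where

open import Defs
open import Level using (Level)
open import Algebra.Bundles using (AbelianGroup)
open import Data.Bool.Base using (Bool; true; false; not; _∧_)
open import Data.Digit using (Bit; 1b; toDigits; fromDigits)
open import Data.Fin.Base using (zero; suc; toℕ)
import Data.Fin.Properties as Fin
open import Data.Integer.Base using (ℤ; +_; 0ℤ; 1ℤ; -1ℤ; -_)
  renaming (_+_ to _+ᶻ_; _*_ to _*ᶻ_)
import Data.Integer.Properties as ℤ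
open import Algebra.Properties.Group (AbelianGroup.group ℤ.+-0-abelianGroup)
  using () renaming (∙-cancelˡ to +ᶻ-cancelˡ; ∙-cancelʳ to +ᶻ-cancelʳ)
open import Data.Integer.Tactic.RingSolver using (solve-∀)
open import Data.List.Base
  using (List; []; _∷_; _++_; _∷ʳ_; map; length; filter; upTo; cartesianProduct)
open import Data.List.Properties using (upTo-∷ʳ)
open import Data.Nat.Base
  using (ℕ; zero; suc; _+_; _*_; _∸_; _<_; _≤_; z<s; s≤s; s≤s⁻¹)
open import Data.Nat.Divisibility using (_∣?_; ∣-refl; ∣m∣n⇒∣m+n; ∣m+n∣m⇒∣n)
open import Data.Nat.Properties
  using (_≟_; _<?_; <-cmp; +-comm; +-identityʳ; *-comm; *-cancelʳ-≡; suc-injective; even≢odd;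
         n<1+n; m<n⇒m<1+n; <⇒≢; <⇒≱; m∸n≤m; m+[n∸m]≡n; m+n∸m≡n; m≤m+n)
open import Data.Product.Base using (_×_; _,_; ∃; proj₁; proj₂)
open import Data.Sum.Base using (_⊎_; inj₁; inj₂)
open import Data.Unit.Base using (tt)
open import Function.Base using (_∘_; flip)
open import Function.Bundles using (_⇔_; mk⇔)
open import Relation.Binary.Definitions using (tri<; tri≈; tri>)
open import Relation.Binary.PropositionalEquality
  using (_≡_; _≢_; _≗_; refl; sym; trans; cong; cong₂; subst; module ≡-Reasoning)
open import Relation.Nullary.Decidable
  using (Dec; yes; no; does; dec-true; dec-false; does-⇔)
open import Relation.Nullary.Negation using (contradiction)
open import Relation.Unary using (Pred; Decidable; _∈_; _∪_; _∩_; _≐_; U; ∅)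

open ≡-Reasoning

private
  variable
    a b : Level
    X Y : Set a

-- The uniqueness argument compares sets only through Boolean values; this leads back from those
-- values to membership.
does-transfer : {P : Set a} {Q : Set b} (p? : Dec P) (q? : Dec Q) →
                does p? ≡ does q? → P → Q
does-transfer p? (yes q) _  _ = q
does-transfer p? (no _)  eq p with () ← trans (sym eq) (dec-true p? p)

-- Integer sums over lists

⟦_⟧ : Bool → ℤ
⟦ true ⟧  = 1ℤ
⟦ false ⟧ = 0ℤ

∑ : (X → ℤ) → List X → ℤ
∑ f []       = 0ℤ
∑ f (x ∷ xs) = f x +ᶻ ∑ f xs

∑-cong : {f g : X → ℤ} → f ≗ g → ∀ xs → ∑ f xs ≡ ∑ g xs
∑-cong f≗g []       = refl
∑-cong f≗g (x ∷ xs) = cong₂ _+ᶻ_ (f≗g x) (∑-cong f≗g xs)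

∑-+ : ∀ (f g : X → ℤ) xs → ∑ (λ x → f x +ᶻ g x) xs ≡ ∑ f xs +ᶻ ∑ g xs
∑-+ f g []       = refl
∑-+ f g (x ∷ xs) =
  trans (cong (f x +ᶻ g x +ᶻ_) (∑-+ f g xs)) (interchange (f x) (g x) (∑ f xs) (∑ g xs))
  where
  interchange : ∀ i j k l → (i +ᶻ j) +ᶻ (k +ᶻ l) ≡ (i +ᶻ k) +ᶻ (j +ᶻ l)
  interchange = solve-∀

∑-*ˡ : ∀ k (f : X → ℤ) xs → ∑ (λ x → k *ᶻ f x) xs ≡ k *ᶻ ∑ f xs
∑-*ˡ k f []       = sym (ℤ.*-zeroʳ k)
∑-*ˡ k f (x ∷ xs) =
  trans (cong (k *ᶻ f x +ᶻ_) (∑-*ˡ k f xs)) (sym (ℤ.*-distribˡ-+ k (f x) (∑ f xs)))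

∑-0 : (xs : List X) → ∑ (λ _ → 0ℤ) xs ≡ 0ℤ
∑-0 []       = refl
∑-0 (x ∷ xs) = trans (ℤ.+-identityˡ _) (∑-0 xs)

∑-++ : ∀ (f : X → ℤ) xs ys → ∑ f (xs ++ ys) ≡ ∑ f xs +ᶻ ∑ f ys
∑-++ f []       ys = sym (ℤ.+-identityˡ _)
∑-++ f (x ∷ xs) ys =
  trans (cong (f x +ᶻ_) (∑-++ f xs ys)) (sym (ℤ.+-assoc (f x) (∑ f xs) (∑ f ys)))

∑-map : ∀ (f : Y → ℤ) (g : X → Y) xs → ∑ f (map g xs) ≡ ∑ (f ∘ g) xs
∑-map f g []       = refl
∑-map f g (x ∷ xs) = cong (f (g x) +ᶻ_) (∑-map f g xs)

∑-comm : ∀ (f : X → Y → ℤ) xs ys →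
         ∑ (λ x → ∑ (f x) ys) xs ≡ ∑ (λ y → ∑ (flip f y) xs) ys
∑-comm f []       ys = sym (∑-0 ys)
∑-comm f (x ∷ xs) ys =
  trans (cong (∑ (f x) ys +ᶻ_) (∑-comm f xs ys))
        (sym (∑-+ (f x) (λ y → ∑ (flip f y) xs) ys))

∑-cartesianProduct : ∀ (f : X × Y → ℤ) xs ys →
  ∑ f (cartesianProduct xs ys) ≡ ∑ (λ x → ∑ (λ y → f (x , y)) ys) xs
∑-cartesianProduct f []       ys = refl
∑-cartesianProduct f (x ∷ xs) ys =
  trans (∑-++ f (map (x ,_) ys) (cartesianProduct xs ys))
        (cong₂ _+ᶻ_ (∑-map f (x ,_) ys) (∑-cartesianProduct f xs ys))

-- Counts become sums of 0-1 indicators, so that linearity and exchange of summation apply to them.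
length-filter-∑ : {P : Pred X b} (P? : Decidable P) → ∀ xs →
                  + length (filter P? xs) ≡ ∑ (⟦_⟧ ∘ does ∘ P?) xs
length-filter-∑ P? []       = refl
length-filter-∑ P? (x ∷ xs) with does (P? x)
... | true  = trans (ℤ.pos-+ 1 _) (cong (1ℤ +ᶻ_) (length-filter-∑ P? xs))
... | false = trans (length-filter-∑ P? xs) (sym (ℤ.+-identityˡ _))

∑-upTo-suc : ∀ f n → ∑ f (upTo (suc n)) ≡ ∑ f (upTo n) +ᶻ f n
∑-upTo-suc f n = begin
  ∑ f (upTo (suc n))            ≡⟨ cong (∑ f) (upTo-∷ʳ n) ⟨
  ∑ f (upTo n ∷ʳ n)             ≡⟨ ∑-++ f (upTo n) (n ∷ []) ⟩
  ∑ f (upTo n) +ᶻ (f n +ᶻ 0ℤ)   ≡⟨ cong (∑ f (upTo n) +ᶻ_) (ℤ.+-identityʳ (f n)) ⟩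
  ∑ f (upTo n) +ᶻ f n           ∎

-- The bound k < n is at hand in the hypothesis because the evaluations of rows below hold only for
-- indices in range.
∑-upTo-cong : ∀ {f g} n → (∀ {k} → k < n → f k ≡ g k) → ∑ f (upTo n) ≡ ∑ g (upTo n)
∑-upTo-cong         zero    f≡g = refl
∑-upTo-cong {f} {g} (suc n) f≡g = begin
  ∑ f (upTo (suc n))    ≡⟨ ∑-upTo-suc f n ⟩
  ∑ f (upTo n) +ᶻ f n   ≡⟨ cong₂ _+ᶻ_ (∑-upTo-cong n (f≡g ∘ m<n⇒m<1+n)) (f≡g (n<1+n n)) ⟩
  ∑ g (upTo n) +ᶻ g n   ≡⟨ ∑-upTo-suc g n ⟨
  ∑ g (upTo (suc n))    ∎

∑-upTo-0 : ∀ {f} n → (∀ {k} → k < n → f k ≡ 0ℤ) → ∑ f (upTo n) ≡ 0ℤ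
∑-upTo-0 n f≡0 = trans (∑-upTo-cong n f≡0) (∑-0 (upTo n))

∑-upTo-single : ∀ f {k} n → k < n → (∀ {i} → i ≢ k → f i ≡ 0ℤ) →
                ∑ f (upTo n) ≡ f k
∑-upTo-single f {k} (suc n) k<1+n f≡0 with <-cmp k n
... | tri< k<n k≢n _ = begin
  ∑ f (upTo (suc n))    ≡⟨ ∑-upTo-suc f n ⟩
  ∑ f (upTo n) +ᶻ f n   ≡⟨ cong₂ _+ᶻ_ (∑-upTo-single f n k<n f≡0) (f≡0 (k≢n ∘ sym)) ⟩
  f k +ᶻ 0ℤ             ≡⟨ ℤ.+-identityʳ (f k) ⟩
  f k                   ∎
... | tri≈ _ refl _ = begin
  ∑ f (upTo (suc n))    ≡⟨ ∑-upTo-suc f n ⟩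
  ∑ f (upTo n) +ᶻ f n   ≡⟨ cong (_+ᶻ f n) (∑-upTo-0 n (f≡0 ∘ <⇒≢)) ⟩
  0ℤ +ᶻ f n             ≡⟨ ℤ.+-identityˡ (f n) ⟩
  f n                   ∎
... | tri> _ _ n<k = contradiction (s≤s⁻¹ k<1+n) (<⇒≱ n<k)

-- The difference of the two representation functions

ε : Bool → ℤ
ε true  = 1ℤ
ε false = -1ℤ

ε-not : ∀ x → ε (not x) ≡ - ε x
ε-not true  = refl
ε-not false = refl

ε-injective : ∀ {x y} → ε x ≡ ε y → x ≡ y
ε-injective {true}  {true}  _ = refl
ε-injective {false} {false} _ = refl

-- The last two conjuncts of `isRepresentation?` after `does`, kept apart from membership in the
-- set.
pair? : ℕ → ℕ → ℕ → Bool
pair? n s s′ = does (s <? s′) ∧ does (s + s′ ≟ n)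

diag? : ℕ → ℕ → ℕ → Bool
diag? n s s′ = does (s ≟ s′) ∧ does (s + s′ ≟ n)

-- Half the sum of two signs is 1, -1 or 0 according as both are 1, both are -1, or they differ.
-- Doubling avoids the half, and moving a term across avoids subtraction.
pair-contribution : ∀ x y w →
  + 2 *ᶻ ⟦ x ∧ y ∧ w ⟧ ≡
  + 2 *ᶻ ⟦ not x ∧ not y ∧ w ⟧ +ᶻ (ε x *ᶻ ⟦ w ⟧ +ᶻ ε y *ᶻ ⟦ w ⟧)
pair-contribution true  true  true  = refl
pair-contribution true  true  false = refl
pair-contribution true  false true  = refl
pair-contribution true  false false = refl
pair-contribution false true  true  = refl
pair-contribution false true  false = refl
pair-contribution false false true  = refl
pair-contribution false false false = refl

-- Exactly one of s < s′, s′ < s and s = s′ holds. The rewrite makes all four indicators test the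
-- same sum s + s′.
pair-trichotomy : ∀ n s s′ →
  ⟦ pair? n s s′ ⟧ +ᶻ ⟦ pair? n s′ s ⟧ +ᶻ ⟦ diag? n s s′ ⟧ ≡ ⟦ does (s + s′ ≟ n) ⟧
pair-trichotomy n s s′ rewrite +-comm s′ s with <-cmp s s′
... | tri< s<s′ s≢s′ s′≮s
  rewrite dec-true (s <? s′) s<s′ | dec-false (s ≟ s′) s≢s′ | dec-false (s′ <? s) s′≮s =
  trans (ℤ.+-identityʳ _) (ℤ.+-identityʳ _)
... | tri≈ s≮s′ s≡s′ s′≮s
  rewrite dec-false (s <? s′) s≮s′ | dec-true (s ≟ s′) s≡s′ | dec-false (s′ <? s) s′≮s =
  ℤ.+-identityˡ _
... | tri> s≮s′ s≢s′ s′<s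
  rewrite dec-false (s <? s′) s≮s′ | dec-false (s ≟ s′) s≢s′ | dec-true (s′ <? s) s′<s =
  trans (ℤ.+-identityʳ _) (ℤ.+-identityˡ _)

-- The only solution is s′ = n ∸ s; truncated subtraction is exact here since s ≤ n.
∑-solutions : ∀ n {s} → s < suc n → ∑ (λ s′ → ⟦ does (s + s′ ≟ n) ⟧) (upTo (suc n)) ≡ 1ℤ
∑-solutions n {s} s≤n = begin
  ∑ (λ s′ → ⟦ does (s + s′ ≟ n) ⟧) (upTo (suc n))
    ≡⟨ ∑-upTo-single _ (suc n) (s≤s (m∸n≤m n s))
         (λ {i} i≢n∸s → cong ⟦_⟧ (dec-false (s + i ≟ n)
           λ { refl → i≢n∸s (sym (m+n∸m≡n s i)) })) ⟩
  ⟦ does (s + (n ∸ s) ≟ n) ⟧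
    ≡⟨ cong ⟦_⟧ (dec-true (s + (n ∸ s) ≟ n) (m+[n∸m]≡n (s≤s⁻¹ s≤n))) ⟩
  1ℤ ∎

∑-diag : ∀ n {s} → s < suc n →
         ∑ (λ s′ → ⟦ diag? n s s′ ⟧) (upTo (suc n)) ≡ ⟦ does (s + s ≟ n) ⟧
∑-diag n {s} s≤n = begin
  ∑ (λ s′ → ⟦ diag? n s s′ ⟧) (upTo (suc n))
    ≡⟨ ∑-upTo-single _ (suc n) s≤n
         (λ {i} i≢s → cong (λ z → ⟦ z ∧ does (s + i ≟ n) ⟧) (dec-false (s ≟ i) (i≢s ∘ sym))) ⟩
  ⟦ diag? n s s ⟧
    ≡⟨ cong (λ z → ⟦ z ∧ does (s + s ≟ n) ⟧) (dec-true (s ≟ s) refl) ⟩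
  ⟦ does (s + s ≟ n) ⟧ ∎

E : (ℕ → Bool) → ℕ → ℤ
E χ n = ∑ (ε ∘ χ) (upTo (suc n))

-- This is the sign at n / 2 for even n and 0 for odd n. As a sum it fits the double-sum argument
-- without a case distinction on parity.
midpoint : (ℕ → Bool) → ℕ → ℤ
midpoint χ n = ∑ (λ s → ε (χ s) *ᶻ ⟦ does (s + s ≟ n) ⟧) (upTo (suc n))

module _ (χ : ℕ → Bool) (n : ℕ) where

  private
    I = upTo (suc n)

    ∑∑ : (ℕ → ℕ → ℤ) → ℤ
    ∑∑ f = ∑ (λ s → ∑ (f s) I) I

    -- The sign always belongs to the first argument, which is the smaller member of the pair in
    -- `lower` and the larger one in `upper`.
    rep corep lower upper diag : ℕ → ℕ → ℤ
    rep   s s′ = ⟦ χ s ∧ χ s′ ∧ pair? n s s′ ⟧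
    corep s s′ = ⟦ not (χ s) ∧ not (χ s′) ∧ pair? n s s′ ⟧
    lower s s′ = ε (χ s) *ᶻ ⟦ pair? n s s′ ⟧
    upper s s′ = ε (χ s) *ᶻ ⟦ pair? n s′ s ⟧
    diag  s s′ = ε (χ s) *ᶻ ⟦ diag? n s s′ ⟧

    ∑∑-+ : ∀ f g → ∑∑ (λ s s′ → f s s′ +ᶻ g s s′) ≡ ∑∑ f +ᶻ ∑∑ g
    ∑∑-+ f g = trans (∑-cong (λ s → ∑-+ (f s) (g s) I) I)
                      (∑-+ (λ s → ∑ (f s) I) (λ s → ∑ (g s) I) I)

    ∑∑-*ˡ : ∀ k f → ∑∑ (λ s s′ → k *ᶻ f s s′) ≡ k *ᶻ ∑∑ f
    ∑∑-*ˡ k f = trans (∑-cong (λ s → ∑-*ˡ k (f s) I) I) (∑-*ˡ k (λ s → ∑ (f s) I) I)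

  ∑-representations : ℤ
  ∑-representations = ∑∑ rep

  ∑-corepresentations : ℤ
  ∑-corepresentations = ∑∑ corep

  representations-pairs :
    + 2 *ᶻ ∑-representations ≡
    + 2 *ᶻ ∑-corepresentations +ᶻ (∑∑ lower +ᶻ ∑∑ upper)
  representations-pairs = begin
    + 2 *ᶻ ∑-representations
      ≡⟨ ∑∑-*ˡ (+ 2) rep ⟨
    ∑∑ (λ s s′ → + 2 *ᶻ rep s s′)
      ≡⟨ ∑-cong (λ s → ∑-cong (λ s′ → pair-contribution (χ s) (χ s′) (pair? n s s′)) I) I ⟩
    ∑∑ (λ s s′ → + 2 *ᶻ corep s s′ +ᶻ (lower s s′ +ᶻ upper s′ s))
      ≡⟨ ∑∑-+ (λ s s′ → + 2 *ᶻ corep s s′) (λ s s′ → lower s s′ +ᶻ upper s′ s) ⟩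
    ∑∑ (λ s s′ → + 2 *ᶻ corep s s′) +ᶻ ∑∑ (λ s s′ → lower s s′ +ᶻ upper s′ s)
      ≡⟨ cong₂ _+ᶻ_ (∑∑-*ˡ (+ 2) corep) (∑∑-+ lower (flip upper)) ⟩
    + 2 *ᶻ ∑-corepresentations +ᶻ (∑∑ lower +ᶻ ∑∑ (flip upper))
      -- Exchanging the summations makes the larger member, whose sign is counted, the outer index.
      ≡⟨ cong (λ z → + 2 *ᶻ ∑-corepresentations +ᶻ (∑∑ lower +ᶻ z))
           (∑-comm (flip upper) I I) ⟩
    + 2 *ᶻ ∑-corepresentations +ᶻ (∑∑ lower +ᶻ ∑∑ upper) ∎

  -- Each s ≤ n has exactly one partner s′ with s + s′ = n, and it is larger than, smaller than or
  -- equal to s. So the three sums together count the sign of s once.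
  pairs-midpoint : (∑∑ lower +ᶻ ∑∑ upper) +ᶻ midpoint χ n ≡ E χ n
  pairs-midpoint = begin
    (∑∑ lower +ᶻ ∑∑ upper) +ᶻ midpoint χ n
      ≡⟨ cong₂ _+ᶻ_ (∑∑-+ lower upper) (∑-upTo-cong (suc n) row-diag) ⟨
    ∑∑ (λ s s′ → lower s s′ +ᶻ upper s s′) +ᶻ ∑∑ diag
      ≡⟨ ∑∑-+ (λ s s′ → lower s s′ +ᶻ upper s s′) diag ⟨
    ∑∑ (λ s s′ → lower s s′ +ᶻ upper s s′ +ᶻ diag s s′)
      ≡⟨ ∑-cong (λ s → ∑-cong (λ s′ → factor (ε (χ s)) s s′) I) I ⟩
    ∑∑ (λ s s′ → ε (χ s) *ᶻ ⟦ does (s + s′ ≟ n) ⟧)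
      ≡⟨ ∑-upTo-cong (suc n) row ⟩
    E χ n ∎
    where
    row-diag : ∀ {s} → s < suc n →
      ∑ (diag s) I ≡ ε (χ s) *ᶻ ⟦ does (s + s ≟ n) ⟧
    row-diag {s} s≤n = trans (∑-*ˡ (ε (χ s)) (λ s′ → ⟦ diag? n s s′ ⟧) I)
                             (cong (ε (χ s) *ᶻ_) (∑-diag n s≤n))

    row : ∀ {s} → s < suc n → ∑ (λ s′ → ε (χ s) *ᶻ ⟦ does (s + s′ ≟ n) ⟧) I ≡ ε (χ s)
    row {s} s≤n = trans (∑-*ˡ (ε (χ s)) (λ s′ → ⟦ does (s + s′ ≟ n) ⟧) I)
      (trans (cong (ε (χ s) *ᶻ_) (∑-solutions n s≤n)) (ℤ.*-identityʳ _))

    distrib : ∀ e i j k → e *ᶻ i +ᶻ e *ᶻ j +ᶻ e *ᶻ k ≡ e *ᶻ (i +ᶻ j +ᶻ k)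
    distrib = solve-∀

    factor : ∀ e s s′ →
      e *ᶻ ⟦ pair? n s s′ ⟧ +ᶻ e *ᶻ ⟦ pair? n s′ s ⟧ +ᶻ e *ᶻ ⟦ diag? n s s′ ⟧ ≡
      e *ᶻ ⟦ does (s + s′ ≟ n) ⟧
    factor e s s′ =
      trans (distrib e ⟦ pair? n s s′ ⟧ ⟦ pair? n s′ s ⟧ ⟦ diag? n s s′ ⟧)
            (cong (e *ᶻ_) (pair-trichotomy n s s′))

  -- Rearranged: twice the difference of the two counts is `E χ n` minus `midpoint χ n`. The
  -- additive form lets either side be cancelled later.
  representation-difference :
    + 2 *ᶻ ∑-representations +ᶻ midpoint χ n ≡
    + 2 *ᶻ ∑-corepresentations +ᶻ E χ n
  representation-difference = begin
    + 2 *ᶻ ∑-representations +ᶻ midpoint χ n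
      ≡⟨ cong (_+ᶻ midpoint χ n) representations-pairs ⟩
    + 2 *ᶻ ∑-corepresentations +ᶻ (∑∑ lower +ᶻ ∑∑ upper) +ᶻ midpoint χ n
      ≡⟨ ℤ.+-assoc (+ 2 *ᶻ ∑-corepresentations) _ _ ⟩
    + 2 *ᶻ ∑-corepresentations +ᶻ ((∑∑ lower +ᶻ ∑∑ upper) +ᶻ midpoint χ n)
      ≡⟨ cong (+ 2 *ᶻ ∑-corepresentations +ᶻ_) pairs-midpoint ⟩
    + 2 *ᶻ ∑-corepresentations +ᶻ E χ n ∎

-- No rewriting of summands is needed: `does` of a `_×-dec_` computes to `_∧_`, which yields the
-- summand `rep`.
R-∑ : {S : Pred ℕ a} (S? : Decidable S) → ∀ n →
      + R S? n ≡ ∑-representations (does ∘ S?) n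
R-∑ S? n = trans
  (length-filter-∑ (isRepresentation? S? n) (cartesianProduct I I))
  (∑-cartesianProduct (⟦_⟧ ∘ does ∘ isRepresentation? S? n) I I)
  where I = upTo (suc n)

R-∑-complement : {S : Pred ℕ a} (S? : Decidable S) (χ : ℕ → Bool) →
                 (∀ s → does (S? s) ≡ not (χ s)) → ∀ n →
                 + R S? n ≡ ∑-corepresentations χ n
R-∑-complement S? χ S≡∁χ n = trans (R-∑ S? n)
  (∑-cong (λ s → ∑-cong (λ s′ →
     cong₂ (λ x y → ⟦ x ∧ y ∧ pair? n s s′ ⟧) (S≡∁χ s) (S≡∁χ s′)) I) I)
  where I = upTo (suc n)

-- The Thue–Morse recursion

n+n≡n*2 : ∀ n → n + n ≡ n * 2
n+n≡n*2 n = trans (cong (λ z → n + z) (sym (+-identityʳ n))) (*-comm 2 n)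

m*2≢1+n*2 : ∀ m n → m * 2 ≢ suc (n * 2)
m*2≢1+n*2 m n eq = even≢odd m n (begin
  2 * m         ≡⟨ *-comm 2 m ⟩
  m * 2         ≡⟨ eq ⟩
  suc (n * 2)   ≡⟨ cong suc (*-comm n 2) ⟩
  suc (2 * n)   ∎)

even-or-odd : ∀ n → ∃ λ m → n ≡ m * 2 ⊎ n ≡ suc (m * 2)
even-or-odd zero = 0 , inj₁ refl
even-or-odd (suc n) with even-or-odd n
... | m , inj₁ eq = m , inj₂ (cong suc eq)
... | m , inj₂ eq = suc m , inj₁ (cong suc eq)

midpoint-even : ∀ χ m → midpoint χ (m * 2) ≡ ε (χ m)
midpoint-even χ m = begin
  midpoint χ (m * 2)
    ≡⟨ ∑-upTo-single _ (suc (m * 2)) (s≤s (subst (m ≤_) (n+n≡n*2 m) (m≤m+n m m)))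
         (λ {i} i≢m → trans
           (cong (λ z → ε (χ i) *ᶻ ⟦ z ⟧) (dec-false (i + i ≟ m * 2)
             (λ eq → i≢m (*-cancelʳ-≡ i m 2 (trans (sym (n+n≡n*2 i)) eq)))))
           (ℤ.*-zeroʳ (ε (χ i)))) ⟩
  ε (χ m) *ᶻ ⟦ does (m + m ≟ m * 2) ⟧
    ≡⟨ cong (λ z → ε (χ m) *ᶻ ⟦ z ⟧) (dec-true (m + m ≟ m * 2) (n+n≡n*2 m)) ⟩
  ε (χ m) *ᶻ 1ℤ
    ≡⟨ ℤ.*-identityʳ _ ⟩
  ε (χ m) ∎

midpoint-odd : ∀ χ m → midpoint χ (suc (m * 2)) ≡ 0ℤ
midpoint-odd χ m = ∑-upTo-0 (suc (suc (m * 2))) (λ {i} _ → trans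
  (cong (λ z → ε (χ i) *ᶻ ⟦ z ⟧) (dec-false (i + i ≟ suc (m * 2))
    (λ eq → m*2≢1+n*2 i m (trans (sym (n+n≡n*2 i)) eq))))
  (ℤ.*-zeroʳ (ε (χ i))))

-- By `representation-difference`, this is the equality of the two representation functions on the
-- positive integers.
Balanced : (ℕ → Bool) → Set
Balanced χ = ∀ n → 0 < n → E χ n ≡ midpoint χ n

-- The recursion leaves the value at 0 free, so it describes the Thue-Morse sequence and its
-- complement alike.
ThueMorse : (ℕ → Bool) → Set
ThueMorse χ = (∀ m → χ (m * 2) ≡ χ m) × (∀ m → χ (suc (m * 2)) ≡ not (χ m))

E-suc : ∀ χ n → E χ (suc n) ≡ E χ n +ᶻ ε (χ (suc n))
E-suc χ n = ∑-upTo-suc (ε ∘ χ) (suc n)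

-- Each sign is a difference of consecutive partial sums: ε(m + 1) - 0 at 2m + 2, and 0 - ε(m) at 2m
-- + 1.
balanced⇒thueMorse : ∀ {χ} → Balanced χ → ThueMorse χ
balanced⇒thueMorse {χ} balanced = even , odd
  where
  E-even : ∀ m → E χ (m * 2) ≡ ε (χ m)
  -- `Balanced` speaks of positive n only; at 0 the partial sum is the single term ε(0).
  E-even zero    = ℤ.+-identityʳ (ε (χ 0))
  E-even (suc m) = trans (balanced (suc m * 2) z<s) (midpoint-even χ (suc m))

  E-odd : ∀ m → E χ (suc (m * 2)) ≡ 0ℤ
  E-odd m = trans (balanced (suc (m * 2)) z<s) (midpoint-odd χ m)

  even : ∀ m → χ (m * 2) ≡ χ m
  even zero    = refl
  even (suc m) = ε-injective (begin
    ε (χ (suc m * 2))                        ≡⟨ ℤ.+-identityˡ _ ⟨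
    0ℤ +ᶻ ε (χ (suc m * 2))                  ≡⟨ cong (_+ᶻ ε (χ (suc m * 2))) (E-odd m) ⟨
    E χ (suc (m * 2)) +ᶻ ε (χ (suc m * 2))   ≡⟨ E-suc χ (suc (m * 2)) ⟨
    E χ (suc m * 2)                          ≡⟨ E-even (suc m) ⟩
    ε (χ (suc m))                            ∎)

  add-cancel : ∀ i j → j ≡ - i +ᶻ (i +ᶻ j)
  add-cancel = solve-∀

  odd : ∀ m → χ (suc (m * 2)) ≡ not (χ m)
  odd m = ε-injective (begin
    ε (χ (suc (m * 2)))
      ≡⟨ add-cancel (ε (χ m)) _ ⟩
    - ε (χ m) +ᶻ (ε (χ m) +ᶻ ε (χ (suc (m * 2))))
      ≡⟨ cong (λ z → - ε (χ m) +ᶻ (z +ᶻ ε (χ (suc (m * 2))))) (E-even m) ⟨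
    - ε (χ m) +ᶻ (E χ (m * 2) +ᶻ ε (χ (suc (m * 2))))
      ≡⟨ cong (- ε (χ m) +ᶻ_) (trans (sym (E-suc χ (m * 2))) (E-odd m)) ⟩
    - ε (χ m) +ᶻ 0ℤ
      ≡⟨ ℤ.+-identityʳ _ ⟩
    - ε (χ m)
      ≡⟨ ε-not (χ m) ⟨
    ε (not (χ m)) ∎)

-- `E-even` and `E-odd` form one induction, each using the partial sum one index earlier: the sign
-- at 2m + 1 cancels ε(m), and the sign at 2m + 2 restores ε(m + 1).
thueMorse⇒balanced : ∀ {χ} → ThueMorse χ → Balanced χ
thueMorse⇒balanced {χ} (even , odd) n _ = helper (even-or-odd n)
  where
  E-even : ∀ m → E χ (m * 2) ≡ ε (χ m)
  E-odd  : ∀ m → E χ (suc (m * 2)) ≡ 0ℤ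

  E-even zero    = ℤ.+-identityʳ (ε (χ 0))
  E-even (suc m) = begin
    E χ (suc m * 2)                          ≡⟨ E-suc χ (suc (m * 2)) ⟩
    E χ (suc (m * 2)) +ᶻ ε (χ (suc m * 2))   ≡⟨ cong₂ _+ᶻ_ (E-odd m) (cong ε (even (suc m))) ⟩
    0ℤ +ᶻ ε (χ (suc m))                      ≡⟨ ℤ.+-identityˡ _ ⟩
    ε (χ (suc m))                            ∎

  E-odd m = begin
    E χ (suc (m * 2))                    ≡⟨ E-suc χ (m * 2) ⟩
    E χ (m * 2) +ᶻ ε (χ (suc (m * 2)))   ≡⟨ cong₂ _+ᶻ_ (E-even m) (cong ε (odd m)) ⟩
    ε (χ m) +ᶻ ε (not (χ m))             ≡⟨ cong (ε (χ m) +ᶻ_) (ε-not (χ m)) ⟩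
    ε (χ m) +ᶻ - ε (χ m)                 ≡⟨ ℤ.+-inverseʳ (ε (χ m)) ⟩
    0ℤ                                   ∎

  helper : (∃ λ m → n ≡ m * 2 ⊎ n ≡ suc (m * 2)) → E χ n ≡ midpoint χ n
  helper (m , inj₁ refl) = trans (E-even m) (sym (midpoint-even χ m))
  helper (m , inj₂ refl) = trans (E-odd m) (sym (midpoint-odd χ m))

-- Binary digits

ones : List Bit → ℕ
ones ds = length (filter (Fin._≟ 1b) ds)

-- Lists start with the least significant digit, so parity forces the heads to agree and halving
-- passes to the tails. Against an empty list only zeros can remain, and these are not counted.
ones-unique : ∀ ds es → fromDigits ds ≡ fromDigits es → ones ds ≡ ones es
ones-unique []              []              _  = refl
ones-unique []              (zero ∷ es)     eq = ones-unique [] es (*-cancelʳ-≡ 0 _ 2 eq)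
ones-unique (zero ∷ ds)     []              eq = ones-unique ds [] (*-cancelʳ-≡ _ 0 2 eq)
ones-unique (zero ∷ ds)     (zero ∷ es)     eq = ones-unique ds es (*-cancelʳ-≡ _ _ 2 eq)
ones-unique (zero ∷ ds)     (suc zero ∷ es) eq =
  contradiction eq (m*2≢1+n*2 (fromDigits ds) (fromDigits es))
ones-unique (suc zero ∷ ds) (zero ∷ es)     eq =
  contradiction (sym eq) (m*2≢1+n*2 (fromDigits es) (fromDigits ds))
ones-unique (suc zero ∷ ds) (suc zero ∷ es) eq =
  cong suc (ones-unique ds es (*-cancelʳ-≡ _ _ 2 (suc-injective eq)))

digits : ℕ → List Bit
digits n = proj₁ (toDigits 2 n)

fromDigits-digits : ∀ n → fromDigits (digits n) ≡ n
fromDigits-digits n = proj₂ (toDigits 2 n)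

-- Any digit list may thus replace the one chosen by `toDigits`, whose algorithm need not be
-- unfolded.
binaryOnes-fromDigits : ∀ ds → binaryOnes (fromDigits ds) ≡ ones ds
binaryOnes-fromDigits ds =
  ones-unique (digits (fromDigits ds)) ds (fromDigits-digits (fromDigits ds))

even? : ℕ → Bool
even? n = does (2 ∣? n)

even?-suc : ∀ n → even? (suc n) ≡ not (even? n)
even?-suc zero          = refl
even?-suc (suc zero)    = refl
even?-suc (suc (suc n)) = begin
  even? (3 + n)         ≡⟨ 2+ (suc n) ⟩
  even? (suc n)         ≡⟨ even?-suc n ⟩
  not (even? n)         ≡⟨ cong not (2+ n) ⟨
  not (even? (2 + n))   ∎
  where
  2+ : ∀ n → even? (2 + n) ≡ even? n
  2+ n = does-⇔ (mk⇔ (λ 2∣2+n → ∣m+n∣m⇒∣n 2∣2+n ∣-refl) (∣m∣n⇒∣m+n ∣-refl))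
                (2 ∣? 2 + n) (2 ∣? n)

-- Digit parity as the solution of the recursion

A? : Decidable A
A? n = 2 ∣? binaryOnes n

-- Passing from m to 2m or 2m + 1 adds a lowest digit 0 or 1, which keeps or flips the parity of the
-- ones.
A-thueMorse : ThueMorse (does ∘ A?)
A-thueMorse = (λ m → cong even? (binaryOnes-∷ zero m)) ,
              (λ m → trans (cong even? (binaryOnes-∷ (suc zero) m)) (even?-suc (binaryOnes m)))
  where
  binaryOnes-∷ : ∀ d m → binaryOnes (toℕ d + m * 2) ≡ ones (d ∷ digits m)
  binaryOnes-∷ d m = trans
    (cong (λ k → binaryOnes (toℕ d + k * 2)) (sym (fromDigits-digits m)))
    (binaryOnes-fromDigits (d ∷ digits m))

-- Induction on the digits instead of the number makes halving structural: a digit 0 keeps both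
-- sides, a digit 1 negates both.
thueMorse-ones : ∀ {χ} → ThueMorse χ → χ 0 ≡ true →
                 ∀ ds → χ (fromDigits ds) ≡ even? (ones ds)
thueMorse-ones     _             χ0 []              = χ0
thueMorse-ones     TM@(even , _) χ0 (zero ∷ ds)     =
  trans (even (fromDigits ds)) (thueMorse-ones TM χ0 ds)
thueMorse-ones {χ} TM@(_ , odd)  χ0 (suc zero ∷ ds) = begin
  χ (suc (fromDigits ds * 2))   ≡⟨ odd (fromDigits ds) ⟩
  not (χ (fromDigits ds))       ≡⟨ cong not (thueMorse-ones TM χ0 ds) ⟩
  not (even? (ones ds))         ≡⟨ even?-suc (ones ds) ⟨
  even? (suc (ones ds))         ∎

thueMorse-unique : ∀ {χ} → ThueMorse χ → χ 0 ≡ true → ∀ n → χ n ≡ does (A? n)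
thueMorse-unique {χ} TM χ0 n =
  trans (cong χ (sym (fromDigits-digits n))) (thueMorse-ones TM χ0 (digits n))

-- Partitions with equal representation functions

theorem2 : ∀ {c d : Level} (C : Pred ℕ c) (D : Pred ℕ d)
    (C∪D≐ℕ : C ∪ D ≐ U) (C∩D≐∅ : C ∩ D ≐ ∅) → 0 ∈ C →
    (∀ n → 0 < n →
    R (partition⇒decidableˡ C∪D≐ℕ C∩D≐∅) n ≡
    R (partition⇒decidableʳ C∪D≐ℕ C∩D≐∅) n)
    ⇔ (C ≐ A × D ≐ B)
theorem2 C D C∪D≐ℕ C∩D≐∅ 0∈C = mk⇔ to from
  where
  C? = partition⇒decidableˡ C∪D≐ℕ C∩D≐∅
  D? = partition⇒decidableʳ C∪D≐ℕ C∩D≐∅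

  χ : ℕ → Bool
  χ = does ∘ C?

  D≡∁C : ∀ n → does (D? n) ≡ not (χ n)
  -- Both deciders branch on this same term, so one match computes both.
  D≡∁C n with proj₂ C∪D≐ℕ {n} tt
  ... | inj₁ _ = refl
  ... | inj₂ _ = refl

  difference : ∀ n → + 2 *ᶻ + R C? n +ᶻ midpoint χ n ≡ + 2 *ᶻ + R D? n +ᶻ E χ n
  difference n = begin
    + 2 *ᶻ + R C? n +ᶻ midpoint χ n
      ≡⟨ cong (λ z → + 2 *ᶻ z +ᶻ midpoint χ n) (R-∑ C? n) ⟩
    + 2 *ᶻ ∑-representations χ n +ᶻ midpoint χ n
      ≡⟨ representation-difference χ n ⟩
    + 2 *ᶻ ∑-corepresentations χ n +ᶻ E χ n
      ≡⟨ cong (λ z → + 2 *ᶻ z +ᶻ E χ n) (R-∑-complement D? χ D≡∁C n) ⟨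
    + 2 *ᶻ + R D? n +ᶻ E χ n ∎

  to : (∀ n → 0 < n → R C? n ≡ R D? n) → C ≐ A × D ≐ B
  to RC≡RD = (C⊆A , A⊆C) , (D⊆B , B⊆D)
    where
    balanced : Balanced χ
    balanced n 0<n = +ᶻ-cancelˡ (+ 2 *ᶻ + R D? n) (E χ n) (midpoint χ n)
      (trans (sym (difference n))
             (cong (λ r → + 2 *ᶻ + r +ᶻ midpoint χ n) (RC≡RD n 0<n)))

    χ≡A : ∀ n → χ n ≡ does (A? n)
    -- That 0 lies in C selects the Thue-Morse sequence over its complement.
    χ≡A = thueMorse-unique (balanced⇒thueMorse balanced) (dec-true (C? 0) 0∈C)

    C⊆A : ∀ {n} → C n → A n
    C⊆A {n} = does-transfer (C? n) (A? n) (χ≡A n)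

    A⊆C : ∀ {n} → A n → C n
    A⊆C {n} = does-transfer (A? n) (C? n) (sym (χ≡A n))

    D⊆B : ∀ {n} → D n → B n
    D⊆B n∈D n∈A = proj₁ C∩D≐∅ (A⊆C n∈A , n∈D)

    B⊆D : ∀ {n} → B n → D n
    B⊆D {n} n∉A with proj₂ C∪D≐ℕ {n} tt
    ... | inj₁ n∈C = contradiction (C⊆A n∈C) n∉A
    ... | inj₂ n∈D = n∈D

  from : C ≐ A × D ≐ B → ∀ n → 0 < n → R C? n ≡ R D? n
  from ((C⊆A , A⊆C) , _) n 0<n =
    -- Once balance turns `E χ n` into the midpoint, the midpoint, the factor 2 and the embedding
    -- into ℤ are cancelled in turn.
    ℤ.+-injective (ℤ.*-cancelˡ-≡ (+ 2) _ _ (+ᶻ-cancelʳ (midpoint χ n) _ _ (begin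
      + 2 *ᶻ + R C? n +ᶻ midpoint χ n   ≡⟨ difference n ⟩
      + 2 *ᶻ + R D? n +ᶻ E χ n          ≡⟨ cong (+ 2 *ᶻ + R D? n +ᶻ_) balanced ⟩
      + 2 *ᶻ + R D? n +ᶻ midpoint χ n   ∎)))
    where
    χ≡A : ∀ n → χ n ≡ does (A? n)
    χ≡A n = does-⇔ (mk⇔ C⊆A A⊆C) (C? n) (A? n)

    thueMorse : ThueMorse χ
    thueMorse =
      (λ m → trans (χ≡A (m * 2)) (trans (proj₁ A-thueMorse m) (sym (χ≡A m)))) ,
      (λ m → trans (χ≡A (suc (m * 2)))
                   (trans (proj₂ A-thueMorse m) (cong not (sym (χ≡A m)))))

    balanced : E χ n ≡ midpoint χ n
    balanced = thueMorse⇒balanced thueMorse n 0<n
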